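{- Let $a,b\in GF(q)\setminus\{0\}$ and let $\mu\in GF(q)$ satisfy $\mu^2=\frac ba\neq1$. For every point $P\in\mathcal B_a$ there are exactly two circles $g,h\in\tau(a,b)$ that are tangential to $\mathcal B_a$ in $P$. Moreover, $g$ is tangential to $\mathcal B_b$ in $\mu P$ and $h$ is tangential to $\mathcal B_b$ in $-\mu P$.
   Context: Let $p$ be an odd prime, $m\ge1$, and $q=p^m$. $GF(q^2)$ denotes the quadratic extension of $GF(q)$, and for $z\in GF(q^2)$ we write $\bar z:=z^{q}$. The Miquelian Möbius plane $\mathbb M(q)$ has point set $GF(q^2)\cup\{\infty\}$ and circles of two types: for $s\in GF(q^2)$ and $c\in GF(q)\setminus\{0\}$, the circle of the first type $\mathcal B^1_{(s,c)}=\{z\in GF(q^2):(z-s)(\bar z-\bar s)=c\}$; for $s\in GF(q^2)\setminus\{0\}$ and $c\in GF(q)$, the circle of the second type $\mathcal B^2_{(s,c)}=\{z\in GF(q^2):\bar s z+s\bar z=c\}\cup\{\infty\}$. Two circles are called tangential if they have exactly one point in common; a circle $g$ is tangential to a circle $\mathcal B$ in $P$ if $g\cap\mathcal B=\{P\}$. For $a\in GF(q)\setminus\{0\}$ put $\mathcal B_a:=\mathcal B^1_{(0,a)}$, and for $a,b\in GF(q)\setminus\{0\}$ let $\tau(a,b)$ be the set of circles tangential to both $\mathcal B_a$ and $\mathcal B_b$. -}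

module Defs where

open import Level using (_⊔_; suc)
open import Algebra.Bundles using (CommutativeRing)
import Algebra.Definitions as AlgDefs
import Algebra.Properties.Semiring.Exp as Exp
open import Algebra.Morphism.Structures using (module RingMorphisms)
open import Data.Fin.Base using (Fin)
open import Data.Nat.Base as ℕ using (ℕ)
open import Data.Product using (Σ; ∃!; _×_; _,_; proj₁)
open import Data.Unit.Polymorphic.Base using (⊤)
open import Data.Empty.Polymorphic using (⊥)
open import Function.Bundles using (Inverse)
import Relation.Binary.Construct.Add.Point.Equality as PointEquality
open import Relation.Binary.PropositionalEquality as ≡ using ()
open import Relation.Nullary.Construct.Add.Point using (Pointed; [_]) renaming (∙ to ∞)
open import Relation.Unary using (Pred; _∩_; _≐_)

-- The library's only fields are Heyting fields, which carry an extra
-- apartness relation; here "nonzero" is plain negation of equality, which for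
-- finite fields is the same thing.
record Field c ℓ : Set (suc (c ⊔ ℓ)) where
  field
    commutativeRing : CommutativeRing c ℓ

  open CommutativeRing commutativeRing public
  open Exp semiring public using (_^_)

  field
    1≉0     : 1# ≉ 0#
    inverse : ∀ x → x ≉ 0# → AlgDefs.Invertible _≈_ 1# _*_ x

  Carrier* : Set (c ⊔ ℓ)
  Carrier* = Σ Carrier (_≉ 0#)

  infixl 7 _/_

  _/_ : Carrier → Carrier* → Carrier
  x / (y , y≉0) = x * proj₁ (inverse y y≉0)

HasOrder : ∀ {c ℓ} → Field c ℓ → ℕ → Set (c ⊔ ℓ)
HasOrder F n = Inverse (Field.setoid F) (≡.setoid (Fin n))

-- GF(q) ⊆ GF(q²): finite fields are determined up to isomorphism by their
-- order, so any fields of these orders are allowed.  The inclusion is a ring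
-- monomorphism ι; the orders force the degree of the extension to be 2.
record QuadraticExtension (q : ℕ) c₁ ℓ₁ c₂ ℓ₂ : Set (suc (c₁ ⊔ ℓ₁ ⊔ c₂ ⊔ ℓ₂)) where
  field
    GFq  : Field c₁ ℓ₁
    GFq² : Field c₂ ℓ₂

  module K = Field GFq
  module L = Field GFq²

  field
    order-K : HasOrder GFq q
    order-L : HasOrder GFq² (q ℕ.^ 2)
    ι       : K.Carrier → L.Carrier
    ι-mono  : RingMorphisms.IsRingMonomorphism K.rawRing L.rawRing ι

module MöbiusPlane {q : ℕ} {c₁ ℓ₁ c₂ ℓ₂} (E : QuadraticExtension q c₁ ℓ₁ c₂ ℓ₂) where

  open QuadraticExtension E public

  conj : L.Carrier → L.Carrier
  conj z = z L.^ q

  Point : Set c₂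
  Point = Pointed L.Carrier

  open PointEquality L._≈_ public using () renaming (_≈∙_ to _≈ₚ_)

  -- B¹ s c and B² s c name circles by their parameters; the circle itself is
  -- the point set ⟦_⟧ below, and different parameters can name the same circle.
  data Circle : Set (c₁ ⊔ ℓ₁ ⊔ c₂ ⊔ ℓ₂) where
    B¹ : (s : L.Carrier)  (c : K.Carrier*) → Circle
    B² : (s : L.Carrier*) (c : K.Carrier)  → Circle

  ⟦_⟧ : Circle → Pred Point ℓ₂
  ⟦ B¹ s (c , _) ⟧ [ z ] = (z L.- s) L.* (conj z L.- conj s) L.≈ ι c
  ⟦ B¹ s (c , _) ⟧ ∞     = ⊥
  ⟦ B² (s , _) c ⟧ [ z ] = conj s L.* z L.+ s L.* conj z L.≈ ι c
  ⟦ B² (s , _) c ⟧ ∞     = ⊤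

  infix 4 _≈ᶜ_

  _≈ᶜ_ : Circle → Circle → Set (c₂ ⊔ ℓ₂)
  g ≈ᶜ h = ⟦ g ⟧ ≐ ⟦ h ⟧

  Tangential : Circle → Circle → Set (c₂ ⊔ ℓ₂)
  Tangential g h = ∃! _≈ₚ_ (⟦ g ⟧ ∩ ⟦ h ⟧)

  TangentialIn : Circle → Circle → Point → Set (c₂ ⊔ ℓ₂)
  TangentialIn g h P = (⟦ g ⟧ ∩ ⟦ h ⟧) ≐ (_≈ₚ P)

  𝓑 : K.Carrier* → Circle
  𝓑 a = B¹ L.0# a

  τ : K.Carrier* → K.Carrier* → Pred Circle (c₂ ⊔ ℓ₂)
  τ a b g = Tangential g (𝓑 a) × Tangential g (𝓑 b)

{-# OPTIONS --safe #-}
module Submission where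

-- Conjugation z ↦ z̄ = z^q is additive, being a power of the Frobenius map, and an
-- involution fixing GF(q), because x^n = x in a field of order n.
--
-- Let k be a circle with centre (or normal vector) s.  On the circle z z̄ = n it is
-- cut out by a linear equation s̄z + s z̄ = t, and z ↦ (s / s̄) z̄ swaps the two
-- solutions; so k touches this circle at z exactly when s ≠ 0 and s̄z = s z̄, that
-- is, when z lies on the line through 0 and s.  If k touches 𝓑 a at P and 𝓑 b at Q,
-- both points lie on that line, whence Q² = μ² P² and Q = ε P with ε = ± μ.
-- Subtracting the two linear equations gives 2 s̄ (Q - P) = b - a for circles of the
-- first type, which forces s = (1 + ε) / 2 · P; for the second type it gives Q = P,
-- contrary to μ² ≠ 1.

open import Defs
open import Algebra.Bundles using (CommutativeMonoid; CommutativeRing; CommutativeSemiring)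
import Algebra.Definitions as AlgebraDefinitions
open import Algebra.Morphism.Structures using (module RingMorphisms)
import Algebra.Properties.AbelianGroup as AbelianGroupProperties
import Algebra.Properties.CommutativeMonoid.Sum as Sum
import Algebra.Properties.CommutativeSemigroup as CommutativeSemigroupProperties
import Algebra.Properties.CommutativeSemiring.Binomial as Binomial
import Algebra.Properties.CommutativeSemiring.Exp as CommutativeExp
import Algebra.Properties.Ring as RingProperties
import Algebra.Properties.Semiring.Mult as Mult
import Algebra.Properties.Semiring.Mult.TCOptimised as TCMult
import Algebra.Solver.Ring as RingSolver
open import Algebra.Solver.Ring.AlmostCommutativeRing using (_-Raw-AlmostCommutative⟶_; fromCommutativeRing)
open import Data.Empty using (⊥-elim)
open import Data.Fin.Base as Fin using (Fin; toℕ; inject₁; fromℕ; punchIn)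
open import Data.Fin.Permutation using (Permutation; permutation)
import Data.Fin.Properties as Fin
import Data.Integer.Base as ℤ
import Data.Integer.Properties as ℤ
open import Data.Maybe.Base using (nothing; just)
open import Data.Nat using (ℕ; _≤_; _^_)
open import Data.Nat.Base as ℕ using (zero; suc; _<_; _!; _∸_; z≤n; s≤s)
open import Data.Nat.Combinatorics using (_C_; nCn≡1; nCk≡n!/k![n-k]!; k![n∸k]!∣n!)
open import Data.Nat.Divisibility using (_∣_; divides; ∣⇒≤; m∣m*n; ∣1⇒≡1; m%n≡0⇒n∣m)
open import Data.Nat.DivMod using (m/n*n≡m; m≡m%n+[m/n]*n; m%n<n; _/_; _%_)
open import Data.Nat.Primality using (Prime; euclidsLemma; ¬prime[0]; ¬prime[1])
import Data.Nat.Properties as ℕ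
open import Data.Product using (∃; ∃₂; _×_; _,_; proj₁; proj₂)
open import Data.Sum using (_⊎_; inj₁; inj₂)
open import Data.Vec.Functional using (Vector; replicate; tail; init; last)
open import Function.Base using (_∘_)
open import Function.Bundles using (Inverse; mk⇔)
open import Level using (_⊔_)
open import Relation.Binary.Construct.Add.Point.Equality using ([_]; [≈]-injective)
open import Relation.Binary.Definitions using (Decidable; WeaklyDecidable)
open import Relation.Binary.PropositionalEquality as ≡ using (_≡_; _≢_)
import Relation.Binary.Reasoning.Setoid as ≈-Reasoning
open import Relation.Nullary using (¬_; yes; no; contradiction)
open import Relation.Nullary.Decidable using (map)
open import Relation.Nullary.Construct.Add.Point using ([_]) renaming (∙ to ∞)
open import Relation.Unary using (_∈_)

-- Ring identities with integer coefficients

module IntegerCoefficients {c ℓ} (R : CommutativeRing c ℓ) where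
  open CommutativeRing R hiding (zero)
  open import Data.Integer.Base using (ℤ; +_; -[1+_]; _⊖_)
  open TCMult semiring renaming (_×_ to infixr 8 _·_; 1+× to 1+·; ×-homo-+ to ·-homo-+; ×1-homo-* to ·1-homo-*)
  open RingProperties ring
  open AbelianGroupProperties +-abelianGroup using (⁻¹-∙-comm)
  open CommutativeSemigroupProperties (CommutativeMonoid.commutativeSemigroup +-commutativeMonoid) using (interchange)
  open ≈-Reasoning setoid

  fromℤ : ℤ → Carrier
  fromℤ (+ n)    = n · 1#
  fromℤ -[1+ n ] = - (suc n · 1#)

  -- If one argument is zero, the other survives up to sign; otherwise inserting `1# - 1#` and
  -- regrouping restores the two ones that `⊖` has cancelled.
  fromℤ-⊖ : ∀ m n → fromℤ (m ⊖ n) ≈ m · 1# - n · 1#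
  fromℤ-⊖ m       zero    = sym (trans (+-congˡ -0#≈0#) (+-identityʳ _))
  fromℤ-⊖ zero    (suc n) = sym (+-identityˡ _)
  fromℤ-⊖ (suc m) (suc n) = begin
    fromℤ (suc m ⊖ suc n)                  ≡⟨ ≡.cong fromℤ (ℤ.[1+m]⊖[1+n]≡m⊖n m n) ⟩
    fromℤ (m ⊖ n)                          ≈⟨ fromℤ-⊖ m n ⟩
    m · 1# - n · 1#                        ≈⟨ +-identityˡ _ ⟨
    0# + (m · 1# - n · 1#)                 ≈⟨ +-congʳ (-‿inverseʳ 1#) ⟨
    (1# - 1#) + (m · 1# - n · 1#)          ≈⟨ interchange _ _ _ _ ⟩
    (1# + m · 1#) + (- 1# - n · 1#)        ≈⟨ +-congˡ (⁻¹-∙-comm 1# (n · 1#)) ⟩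
    (1# + m · 1#) - (1# + n · 1#)          ≈⟨ +-cong (1+· m 1#) (-‿cong (1+· n 1#)) ⟨
    suc m · 1# - suc n · 1#                ∎

  fromℤ-neg : ∀ i → fromℤ (ℤ.- i) ≈ - fromℤ i
  fromℤ-neg (+ zero)  = sym -0#≈0#
  fromℤ-neg (+ suc n) = refl
  fromℤ-neg -[1+ n ]  = sym (-‿involutive _)

  fromℤ-+ : ∀ i j → fromℤ (i ℤ.+ j) ≈ fromℤ i + fromℤ j
  fromℤ-+ (+ m)    (+ n)    = ·-homo-+ 1# m n
  fromℤ-+ (+ m)    -[1+ n ] = fromℤ-⊖ m (suc n)
  fromℤ-+ -[1+ m ] (+ n)    = trans (fromℤ-⊖ n (suc m)) (+-comm _ _)
  fromℤ-+ -[1+ m ] -[1+ n ] = begin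
    - (suc (suc (m ℕ.+ n)) · 1#)      ≡⟨ ≡.cong (λ k → - (k · 1#)) (ℕ.+-suc (suc m) n) ⟨
    - ((suc m ℕ.+ suc n) · 1#)        ≈⟨ -‿cong (·-homo-+ 1# (suc m) (suc n)) ⟩
    - (suc m · 1# + suc n · 1#)       ≈⟨ ⁻¹-∙-comm _ _ ⟨
    - (suc m · 1#) - suc n · 1#       ∎

  fromℤ-* : ∀ i j → fromℤ (i ℤ.* j) ≈ fromℤ i * fromℤ j
  -- Signs are pulled out of either factor until only a product of natural numbers is left.
  fromℤ-* = λ where
      (+ m)    j → pos m j
      -[1+ m ] j → begin
        fromℤ (-[1+ m ] ℤ.* j)         ≡⟨ ≡.cong fromℤ (ℤ.neg-distribˡ-* (+ suc m) j) ⟨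
        fromℤ (ℤ.- (+ suc m ℤ.* j))    ≈⟨ fromℤ-neg (+ suc m ℤ.* j) ⟩
        - fromℤ (+ suc m ℤ.* j)        ≈⟨ -‿cong (pos (suc m) j) ⟩
        - (suc m · 1# * fromℤ j)       ≈⟨ -‿distribˡ-* _ _ ⟩
        - (suc m · 1#) * fromℤ j       ∎
    where
    pos-pos : ∀ m n → fromℤ (+ m ℤ.* + n) ≈ m · 1# * n · 1#
    pos-pos m n = trans (reflexive (≡.cong fromℤ (≡.sym (ℤ.pos-* m n)))) (·1-homo-* m n)

    pos : ∀ m j → fromℤ (+ m ℤ.* j) ≈ m · 1# * fromℤ j
    pos m (+ n)    = pos-pos m n
    pos m -[1+ n ] = begin
      fromℤ (+ m ℤ.* -[1+ n ])         ≡⟨ ≡.cong fromℤ (ℤ.neg-distribʳ-* (+ m) (+ suc n)) ⟨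
      fromℤ (ℤ.- (+ m ℤ.* + suc n))    ≈⟨ fromℤ-neg (+ m ℤ.* + suc n) ⟩
      - fromℤ (+ m ℤ.* + suc n)        ≈⟨ -‿cong (pos-pos m (suc n)) ⟩
      - (m · 1# * suc n · 1#)          ≈⟨ -‿distribʳ-* _ _ ⟩
      m · 1# * - (suc n · 1#)          ∎

  homomorphism : ℤ.+-*-rawRing -Raw-AlmostCommutative⟶ fromCommutativeRing R
  homomorphism = record
    { ⟦_⟧    = fromℤ
    ; +-homo = fromℤ-+
    ; *-homo = fromℤ-*
    ; -‿homo = fromℤ-neg
    ; 0-homo = refl
    ; 1-homo = refl
    }

  -- Distinct integers may have the same image, so `nothing` leaves their comparison open;
  -- normalising polynomials needs positive answers only.
  fromℤ-≟ : WeaklyDecidable (λ i j → fromℤ i ≈ fromℤ j)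
  fromℤ-≟ i j with i ℤ.≟ j
  ... | yes ≡.refl = just refl
  ... | no _       = nothing

  open RingSolver ℤ.+-*-rawRing (fromCommutativeRing R) homomorphism fromℤ-≟ public
    using (Polynomial; solve; _:=_; _:+_; _:*_; _:-_; :-_; con)

-- The Frobenius endomorphism

-- All factors of `k !` are positive and below `p`, and by Euclid's lemma `p` would have to divide
-- one of them.
prime∤! : ∀ {p k} → Prime p → k < p → ¬ p ∣ k !
prime∤! {k = zero}  pp k<p p∣1 = ¬prime[1] (≡.subst Prime (∣1⇒≡1 p∣1) pp)
prime∤! {k = suc k} pp k<p p∣k! with euclidsLemma (suc k) (k !) pp p∣k!
... | inj₁ p∣1+k = ℕ.<⇒≱ k<p (∣⇒≤ p∣1+k)
... | inj₂ p∣k!′ = prime∤! pp (ℕ.<-trans (ℕ.n<1+n k) k<p) p∣k!′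

-- The prime divides p! = C(p, k) k! (p - k)!, but neither of the two smaller factorials.
prime∣C : ∀ {p k} → Prime p → 0 < k → k < p → p ∣ p C k
prime∣C {zero}      pp _ _ = contradiction pp ¬prime[0]
prime∣C {p@(suc n)} {k} pp 0<k k<p
  with euclidsLemma (p C k) (k ! ℕ.* (p ∸ k) !) pp (≡.subst (p ∣_) (≡.sym C*k!*[p∸k]!≡p!) (m∣m*n (n !)))
  where
  instance _ = k ℕ.!* (p ∸ k) !≢0
  C*k!*[p∸k]!≡p! : (p C k) ℕ.* (k ! ℕ.* (p ∸ k) !) ≡ p !
  C*k!*[p∸k]!≡p! = ≡.trans
    (≡.cong (ℕ._* (k ! ℕ.* (p ∸ k) !)) (nCk≡n!/k![n-k]! (ℕ.<⇒≤ k<p)))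
    (m/n*n≡m (k![n∸k]!∣n! (ℕ.<⇒≤ k<p)))
... | inj₁ p∣C = p∣C
... | inj₂ p∣k!*[p∸k]! with euclidsLemma (k !) ((p ∸ k) !) pp p∣k!*[p∸k]!
...   | inj₁ p∣k!     = contradiction p∣k! (prime∤! pp k<p)
...   | inj₂ p∣[p∸k]! = contradiction p∣[p∸k]! (prime∤! pp (ℕ.∸-monoʳ-< 0<k (ℕ.<⇒≤ k<p)))

module Frobenius {c ℓ} (R : CommutativeSemiring c ℓ) where
  open CommutativeSemiring R hiding (zero)
  open CommutativeExp R renaming (_^_ to infixr 8 _^ʳ_)
  open Mult semiring renaming (_×_ to infixr 8 _·_)
  open Sum +-commutativeMonoid using (sum; sum-cong-≋; sum-replicate-zero; sum-init-last)
  open Binomial R using (binomialTerm; theorem)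
  open ≈-Reasoning setoid

  module _ {p} (p-prime : Prime p) (p≈0 : p · 1# ≈ 0#) where

    -- Writing `x` as `1# * x` gives `p · x ≈ (p · 1#) * x`, which is zero in characteristic `p`.
    ·-vanishes : ∀ {n} x → p ∣ n → n · x ≈ 0#
    ·-vanishes x (divides k ≡.refl) = begin
      (k ℕ.* p) · x          ≈⟨ ×-assocˡ x k p ⟨
      k · p · x              ≈⟨ ×-congʳ k (×-congʳ p (*-identityˡ x)) ⟨
      k · p · (1# * x)       ≈⟨ ×-congʳ k (×-assoc-* p 1# x) ⟨
      k · ((p · 1#) * x)     ≈⟨ ×-congʳ k (trans (*-congʳ p≈0) (zeroˡ x)) ⟩
      k · 0#                 ≈⟨ ×-congʳ k (zeroˡ 0#) ⟨
      k · (0# * 0#)          ≈⟨ ×-comm-* k 0# 0# ⟨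
      0# * k · 0#            ≈⟨ zeroˡ _ ⟩
      0#                     ∎

    -- In the binomial expansion every inner coefficient is divisible by `p`, so only the two outer
    -- terms survive.
    frobenius-+ : ∀ x y → (x + y) ^ʳ p ≈ x ^ʳ p + y ^ʳ p
    frobenius-+ x y = expand p ≡.refl
      where
      -- Exposing the exponent as a successor lets the sum be split into its first term, `n` inner
      -- terms and its last term.
      expand : ∀ n → p ≡ n → (x + y) ^ʳ p ≈ x ^ʳ p + y ^ʳ p
      expand zero    p≡0    = contradiction (≡.subst Prime p≡0 p-prime) ¬prime[0]
      expand (suc n) ≡.refl = begin
        (x + y) ^ʳ suc n             ≈⟨ theorem (suc n) x y ⟩
        t Fin.zero + sum (tail t)    ≈⟨ +-cong first (sum-init-last (tail t)) ⟩
        y ^ʳ suc n + (sum (init (tail t)) + last (tail t))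
          ≈⟨ +-congˡ (+-cong middle final) ⟩
        y ^ʳ suc n + (0# + x ^ʳ suc n)
          ≈⟨ +-congˡ (+-identityˡ _) ⟩
        y ^ʳ suc n + x ^ʳ suc n      ≈⟨ +-comm _ _ ⟩
        x ^ʳ suc n + y ^ʳ suc n      ∎
        where
        t : Vector Carrier (suc (suc n))
        t = binomialTerm x y (suc n)

        first : t Fin.zero ≈ y ^ʳ suc n
        first = trans (×-homo-1 _) (*-identityˡ _)

        middle : sum (init (tail t)) ≈ 0#
        middle = trans (sum-cong-≋ vanish) (sum-replicate-zero n)
          where
          vanish : ∀ (i : Fin n) → t (Fin.suc (inject₁ i)) ≈ 0#
          -- The inner index `i` stands for the exponent `toℕ i + 1`, which lies strictly between 0
          -- and `p`.
          vanish i = ·-vanishes _ (prime∣C p-prime (s≤s z≤n)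
            (s≤s (≡.subst (_< n) (≡.sym (Fin.toℕ-inject₁ i)) (Fin.toℕ<n i))))

        final : last (tail t) ≈ x ^ʳ suc n
        final = begin
          (suc n C suc (toℕ (fromℕ n))) · (x ^ʳ suc (toℕ (fromℕ n)) * y ^ʳ (n ∸ toℕ (fromℕ n)))
            ≡⟨ ≡.cong (λ k → (suc n C suc k) · (x ^ʳ suc k * y ^ʳ (n ∸ k))) (Fin.toℕ-fromℕ n) ⟩
          (suc n C suc n) · (x ^ʳ suc n * y ^ʳ (n ∸ n))
            ≡⟨ ≡.cong₂ (λ k l → k · (x ^ʳ suc n * y ^ʳ l)) (nCn≡1 (suc n)) (ℕ.n∸n≡0 n) ⟩
          1 · (x ^ʳ suc n * 1#)
            ≈⟨ trans (×-homo-1 _) (*-identityʳ _) ⟩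
          x ^ʳ suc n
            ∎

    frobenius^-+ : ∀ m x y → (x + y) ^ʳ (p ^ m) ≈ x ^ʳ (p ^ m) + y ^ʳ (p ^ m)
    frobenius^-+ zero    x y = trans (*-identityʳ _) (sym (+-cong (*-identityʳ _) (*-identityʳ _)))
    frobenius^-+ (suc m) x y = begin
      (x + y) ^ʳ (p ℕ.* p ^ m)                     ≈⟨ ^-assocʳ (x + y) p (p ^ m) ⟨
      ((x + y) ^ʳ p) ^ʳ (p ^ m)                    ≈⟨ ^-congˡ (p ^ m) (frobenius-+ x y) ⟩
      (x ^ʳ p + y ^ʳ p) ^ʳ (p ^ m)                 ≈⟨ frobenius^-+ m _ _ ⟩
      (x ^ʳ p) ^ʳ (p ^ m) + (y ^ʳ p) ^ʳ (p ^ m)    ≈⟨ +-cong (^-assocʳ x p (p ^ m)) (^-assocʳ y p (p ^ m)) ⟩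
      x ^ʳ (p ℕ.* p ^ m) + y ^ʳ (p ℕ.* p ^ m)      ∎

-- Finite fields

module FieldProperties {c ℓ} (F : Field c ℓ) where
  open Field F hiding (zero; _/_)
  open Mult semiring renaming (_×_ to infixr 8 _·_)
  open ≈-Reasoning setoid

  *-cancelˡ-≉0 : ∀ {x} → x ≉ 0# → ∀ {y z} → x * y ≈ x * z → y ≈ z
  *-cancelˡ-≉0 {x} x≉0 {y} {z} xy≈xz with inverse x x≉0
  ... | x⁻¹ , x⁻¹x≈1 , _ = trans (sym (x⁻¹[xw]≈w y)) (trans (*-congˡ xy≈xz) (x⁻¹[xw]≈w z))
    where
    x⁻¹[xw]≈w : ∀ w → x⁻¹ * (x * w) ≈ w
    x⁻¹[xw]≈w w = trans (sym (*-assoc _ _ _)) (trans (*-congʳ x⁻¹x≈1) (*-identityˡ w))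

  x*y≈0⇒y≈0 : ∀ {x y} → x ≉ 0# → x * y ≈ 0# → y ≈ 0#
  x*y≈0⇒y≈0 {x} x≉0 xy≈0 = *-cancelˡ-≉0 x≉0 (trans xy≈0 (sym (zeroʳ x)))

  *-≉0 : ∀ {x y} → x ≉ 0# → y ≉ 0# → x * y ≉ 0#
  *-≉0 x≉0 y≉0 xy≈0 = y≉0 (x*y≈0⇒y≈0 x≉0 xy≈0)

  -- An odd `p` equals 1 + 2 (p / 2), so `1# + 1# ≈ 0#` would turn `p · 1# ≈ 0#` into `1# ≈ 0#`.
  characteristic-odd : ∀ {p} → ¬ 2 ∣ p → p · 1# ≈ 0# → 1# + 1# ≉ 0#
  characteristic-odd {p} 2∤p p≈0 2≈0 with p % 2 in p%2≡r | m%n<n p 2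
  ... | 0 | _ = 2∤p (m%n≡0⇒n∣m p 2 p%2≡r)
  ... | 1 | _ = 1≉0 (begin
    1#                              ≈⟨ +-identityʳ 1# ⟨
    1# + 0#                         ≈⟨ +-congˡ (zeroʳ _) ⟨
    1# + (p / 2) · 1# * 0#          ≈⟨ +-congˡ (*-congˡ (trans (+-congˡ (+-identityʳ 1#)) 2≈0)) ⟨
    1# + (p / 2) · 1# * 2 · 1#      ≈⟨ +-congˡ (×1-homo-* (p / 2) 2) ⟨
    (1 ℕ.+ p / 2 ℕ.* 2) · 1#        ≡⟨ ≡.cong (λ r → (r ℕ.+ p / 2 ℕ.* 2) · 1#) p%2≡r ⟨
    (p % 2 ℕ.+ p / 2 ℕ.* 2) · 1#    ≡⟨ ≡.cong (_· 1#) (m≡m%n+[m/n]*n p 2) ⟨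
    p · 1#                          ≈⟨ p≈0 ⟩
    0#                              ∎)
  ... | suc (suc _) | s≤s (s≤s ())

-- Half the sum and half the difference of 1 and ε

module HalfSumAndDifference {c ℓ} (F : Field c ℓ)
  (2≉0 : ¬ Field._≈_ F (Field._+_ F (Field.1# F) (Field.1# F)) (Field.0# F))
  (ε : Field.Carrier F) (ε²≉1 : ¬ Field._≈_ F (Field._*_ F ε ε) (Field.1# F)) where
  open Field F hiding (zero; _/_)
  open IntegerCoefficients commutativeRing

  private
    ½ : AlgebraDefinitions.Invertible _≈_ 1# _*_ (1# + 1#)
    ½ = inverse (1# + 1#) 2≉0

    𝟏 : ∀ {k} → Polynomial k
    𝟏 = con ℤ.1ℤ

  -- Multiplied by `P`, these become the centre of the circle with diameter from `P` to `ε P` and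
  -- the vector from the centre to `P`.
  half-sum half-difference : Carrier
  half-sum        = proj₁ ½ * (1# + ε)
  half-difference = proj₁ ½ * (1# - ε)

  sum≈1 : half-sum + half-difference ≈ 1#
  sum≈1 = trans
    (solve 2 (λ h e → h :* (𝟏 :+ e) :+ h :* (𝟏 :- e) := h :* (𝟏 :+ 𝟏)) refl (proj₁ ½) ε)
    (proj₁ (proj₂ ½))

  difference≈ε : half-sum - half-difference ≈ ε
  difference≈ε = trans
    (solve 2 (λ h e → h :* (𝟏 :+ e) :- h :* (𝟏 :- e) := h :* (𝟏 :+ 𝟏) :* e) refl (proj₁ ½) ε)
    (trans (*-congʳ (proj₁ (proj₂ ½))) (*-identityˡ ε))

  -- From (x - y)² = (x + y)² - 4xy, a vanishing product would give ε² = 1. Both factors are thereby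
  -- nonzero, as the centre and the radius of the tangent circle require.
  product≉0 : half-sum * half-difference ≉ 0#
  product≉0 xy≈0 = ε²≉1 (begin
    ε * ε                                          ≈⟨ *-cong difference≈ε difference≈ε ⟨
    (x - y) * (x - y)                              ≈⟨ solve 2 (λ x y → (x :- y) :* (x :- y) :=
                                                        (x :+ y) :* (x :+ y) :- (𝟏 :+ 𝟏) :* (𝟏 :+ 𝟏) :* (x :* y))
                                                        refl x y ⟩
    (x + y) * (x + y) - (1# + 1#) * (1# + 1#) * (x * y)
                                                   ≈⟨ +-cong (*-cong sum≈1 sum≈1) (-‿cong (*-congˡ xy≈0)) ⟩
    1# * 1# - (1# + 1#) * (1# + 1#) * 0#           ≈⟨ solve 0 (𝟏 :* 𝟏 :- (𝟏 :+ 𝟏) :* (𝟏 :+ 𝟏) :* con ℤ.0ℤ := 𝟏) refl ⟩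
    1#                                             ∎)
    where
    open ≈-Reasoning setoid
    x y : Carrier
    x = half-sum
    y = half-difference

  half-sum≉0 : half-sum ≉ 0#
  half-sum≉0 x≈0 = product≉0 (trans (*-congʳ x≈0) (zeroˡ _))

  half-difference≉0 : half-difference ≉ 0#
  half-difference≉0 y≈0 = product≉0 (trans (*-congˡ y≈0) (zeroʳ _))

module FiniteField {c ℓ n} (F : Field c ℓ) (order : HasOrder F n) where
  open Field F hiding (zero) renaming (_^_ to infixr 8 _^ʳ_)
  open FieldProperties F
  open Inverse order using (to; from; to-cong; from-cong; strictlyInverseˡ; strictlyInverseʳ)
  open Mult semiring renaming (_×_ to infixr 8 _·_)
  open CommutativeExp commutativeSemiring using (^-congˡ)
  open RingProperties ring using (+-cancelʳ)

  infix 4 _≟_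

  _≟_ : Decidable _≈_
  x ≟ y = map (mk⇔ (λ e → trans (sym (strictlyInverseʳ x)) (trans (from-cong e) (strictlyInverseʳ y))) to-cong)
              (to x Fin.≟ to y)

  module _ {c′ ℓ′} (M : CommutativeMonoid c′ ℓ′) where
    private
      module M = CommutativeMonoid M
      module ∑ = Sum M

    -- Conjugating `f` and its inverse `g` with the enumeration gives a permutation of the indices.
    -- An arbitrary commutative monoid is allowed because both sums and products are reindexed
    -- below.
    sum-reindex : ∀ {f g : Carrier → Carrier} {h : Carrier → M.Carrier} →
                  (∀ {x y} → x ≈ y → f x ≈ f y) → (∀ {x y} → x ≈ y → g x ≈ g y) →
                  (∀ x → f (g x) ≈ x) → (∀ x → g (f x) ≈ x) →
                  (∀ {x y} → x ≈ y → h x M.≈ h y) →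
                  ∑.sum (h ∘ from) M.≈ ∑.sum (h ∘ f ∘ from)
    sum-reindex {f} {g} {h} f-cong g-cong fg gf h-cong =
      M.trans (∑.sum-permute (h ∘ from) π) (∑.sum-cong-≋ (λ i → h-cong (strictlyInverseʳ (f (from i)))))
      where
      π : Permutation n n
      π = permutation (to ∘ f ∘ from) (to ∘ g ∘ from)
        (λ i → ≡.trans (to-cong (trans (f-cong (strictlyInverseʳ _)) (fg _))) (strictlyInverseˡ i))
        (λ i → ≡.trans (to-cong (trans (g-cong (strictlyInverseʳ _)) (gf _))) (strictlyInverseˡ i))

    sum-supported-at : ∀ {k} (t : Vector M.Carrier k) i → (∀ j → j ≢ i → t j M.≈ M.ε) → ∑.sum t M.≈ t i
    sum-supported-at {suc k} t i vanish = M.trans (∑.sum-remove {i = i} t)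
      (M.trans (M.∙-congˡ (M.trans (∑.sum-cong-≋ (λ j → vanish (punchIn i j) (Fin.punchInᵢ≢i i j)))
                                   (∑.sum-replicate-zero k)))
               (M.identityʳ _))

  -- Translation by 1 permutes the field, so it does not change the sum of all elements.
  order·1≈0 : n · 1# ≈ 0#
  order·1≈0 = sym (+-cancelʳ S 0# (n · 1#) (begin
    0# + S                     ≈⟨ +-identityˡ S ⟩
    S                          ≈⟨ sum-reindex +-commutativeMonoid {f = 1# +_} {g = - 1# +_} {h = λ x → x}
                                    +-congˡ +-congˡ (cancel (-‿inverseʳ 1#)) (cancel (-‿inverseˡ 1#)) (λ e → e) ⟩
    sum (λ i → 1# + from i)    ≈⟨ ∑-distrib-+ (replicate n 1#) from ⟩
    sum (replicate n 1#) + S   ≈⟨ +-congʳ (sum-replicate n) ⟩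
    n · 1# + S                 ∎))
    where
    open Sum +-commutativeMonoid using (sum; sum-replicate; ∑-distrib-+)
    open ≈-Reasoning setoid
    S : Carrier
    S = sum from
    cancel : ∀ {u v} → u + v ≈ 0# → ∀ x → u + (v + x) ≈ x
    cancel e x = trans (sym (+-assoc _ _ x)) (trans (+-congʳ e) (+-identityˡ x))

  -- The element `(p ^ k) · 1#` is a product of `k` copies of `p · 1#`, and a field has no zero
  -- divisors.
  characteristic-root : ∀ p k → (p ^ k) · 1# ≈ 0# → p · 1# ≈ 0#
  characteristic-root p zero    e = contradiction (trans (sym (+-identityʳ 1#)) e) 1≉0
  characteristic-root p (suc k) e with p · 1# ≟ 0#
  ... | yes p≈0 = p≈0
  ... | no  p≉0 = characteristic-root p k (x*y≈0⇒y≈0 p≉0 (trans (sym (×1-homo-* p (p ^ k))) e))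

  -- Multiplication by x ≉ 0# permutes the nonzero elements, so the n - 1 factors x
  -- at the nonzero elements multiply to 1#; the remaining factor x of x ^ n sits at 0#.
  ^-order : ∀ x → x ^ʳ n ≈ x
  ^-order x with x ≟ 0#
  ... | yes x≈0 = trans (^-congˡ n x≈0) (trans (0^k≈0 (to 0#)) (sym x≈0))
    where
    -- The index of `0#` shows that the order is positive; the zeroth power would be `1#`.
    0^k≈0 : ∀ {k} → Fin k → 0# ^ʳ k ≈ 0#
    0^k≈0 {suc k} _ = zeroˡ _
  ... | no x≉0 = begin
    x ^ʳ n                                        ≈⟨ sum-replicate n ⟨
    sum (replicate n x)                           ≈⟨ sum-cong-≋ (λ i → sym (split (from i))) ⟩
    sum (λ i → off0 (from i) * at0 (from i))      ≈⟨ ∑-distrib-+ (off0 ∘ from) (at0 ∘ from) ⟩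
    sum (off0 ∘ from) * sum (at0 ∘ from)          ≈⟨ *-cong product-off0 product-at0 ⟩
    1# * x                                        ≈⟨ *-identityˡ x ⟩
    x                                             ∎
    where
    open Sum *-commutativeMonoid using (sum; sum-cong-≋; sum-replicate; ∑-distrib-+)
    open ≈-Reasoning setoid

    atZero : Carrier → Carrier → Carrier → Carrier
    atZero u v y with y ≟ 0#
    ... | yes _ = u
    ... | no  _ = v

    atZero-yes : ∀ {u v y} → y ≈ 0# → atZero u v y ≈ u
    atZero-yes {y = y} y≈0 with y ≟ 0#
    ... | yes _   = refl
    ... | no  y≉0 = contradiction y≈0 y≉0

    atZero-no : ∀ {u v y} → y ≉ 0# → atZero u v y ≈ v
    atZero-no {y = y} y≉0 with y ≟ 0#
    ... | yes y≈0 = contradiction y≈0 y≉0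
    ... | no  _   = refl

    -- The constant factor `x` is split into its occurrences away from `0#` and the one at `0#`.
    -- Replacing `0#` by `1#` in `unit` makes the product over the whole field nonzero, hence
    -- cancellable.
    off0 at0 unit : Carrier → Carrier
    off0   = atZero 1# x
    at0    = atZero x 1#
    unit y = atZero 1# y y

    split : ∀ y → off0 y * at0 y ≈ x
    split y with y ≟ 0#
    ... | yes _ = *-identityˡ x
    ... | no  _ = *-identityʳ x

    unit≉0 : ∀ y → unit y ≉ 0#
    unit≉0 y with y ≟ 0#
    ... | yes _   = 1≉0
    ... | no  y≉0 = y≉0

    unit-cong : ∀ {y z} → y ≈ z → unit y ≈ unit z
    unit-cong {y} {z} y≈z with z ≟ 0#
    ... | yes z≈0 = atZero-yes (trans y≈z z≈0)
    ... | no  z≉0 = trans (atZero-no (λ y≈0 → z≉0 (trans (sym y≈z) y≈0))) y≈z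

    unit-* : ∀ y → unit (x * y) ≈ off0 y * unit y
    unit-* y with y ≟ 0#
    ... | yes y≈0 = trans (atZero-yes (trans (*-congˡ y≈0) (zeroʳ x))) (sym (*-identityˡ 1#))
    ... | no  y≉0 = atZero-no (*-≉0 x≉0 y≉0)

    product-≉0 : ∀ {k} (t : Vector Carrier k) → (∀ i → t i ≉ 0#) → sum t ≉ 0#
    product-≉0 {zero}  t t≉0 = 1≉0
    product-≉0 {suc k} t t≉0 = *-≉0 (t≉0 Fin.zero) (product-≉0 (tail t) (t≉0 ∘ Fin.suc))

    x⁻¹ : Carrier
    x⁻¹ = proj₁ (inverse x x≉0)

    cancel : ∀ {u v} → u * v ≈ 1# → ∀ y → u * (v * y) ≈ y
    cancel e y = trans (sym (*-assoc _ _ y)) (trans (*-congʳ e) (*-identityˡ y))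

    -- Multiplication by `x` leaves the product of all `unit` values unchanged, but by `unit-*` it
    -- also contributes the product of `off0`.
    product-off0 : sum (off0 ∘ from) ≈ 1#
    product-off0 = *-cancelˡ-≉0 (product-≉0 (unit ∘ from) (unit≉0 ∘ from)) (begin
      sum (unit ∘ from) * sum (off0 ∘ from)            ≈⟨ *-comm _ _ ⟩
      sum (off0 ∘ from) * sum (unit ∘ from)            ≈⟨ ∑-distrib-+ (off0 ∘ from) (unit ∘ from) ⟨
      sum (λ i → off0 (from i) * unit (from i))        ≈⟨ sum-cong-≋ (λ i → sym (unit-* (from i))) ⟩
      sum (λ i → unit (x * from i))                    ≈⟨ sum-reindex *-commutativeMonoid {f = x *_} {g = x⁻¹ *_}
                                                            *-congˡ *-congˡ
                                                            (cancel (proj₂ (proj₂ (inverse x x≉0))))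
                                                            (cancel (proj₁ (proj₂ (inverse x x≉0))))
                                                            unit-cong ⟨
      sum (unit ∘ from)                                ≈⟨ *-identityʳ _ ⟨
      sum (unit ∘ from) * 1#                           ∎)

    product-at0 : sum (at0 ∘ from) ≈ x
    product-at0 = trans
      (sum-supported-at *-commutativeMonoid (at0 ∘ from) (to 0#)
        (λ i i≢0 → atZero-no (λ e → i≢0 (≡.trans (≡.sym (strictlyInverseˡ i)) (to-cong e)))))
      (atZero-yes (strictlyInverseʳ 0#))

-- Circles tangential to 𝓑 a

module Tangency {c₁ ℓ₁ c₂ ℓ₂} (p m : ℕ) (p-prime : Prime p) (2∤p : ¬ 2 ∣ p)
                (E : QuadraticExtension (p ^ m) c₁ ℓ₁ c₂ ℓ₂) where
  open MöbiusPlane E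
  open L hiding (zero; _/_) renaming (_^_ to infixr 8 _^ʳ_)
  open FieldProperties GFq² hiding (characteristic-odd)
  open FiniteField GFq² order-L using (_≟_; ^-order; order·1≈0; characteristic-root)
  open CommutativeExp commutativeSemiring using (^-congˡ; ^-congʳ; ^-assocʳ; ^-distrib-*)
  open IntegerCoefficients commutativeRing
  open RingProperties ring using (x∙y⁻¹≈ε⇒x≈y; -‿distribˡ-*) renaming (+-inverseʳ-unique to inverseʳ-unique)
  open ≈-Reasoning setoid
  open RingMorphisms.IsRingMonomorphism ι-mono
    using (+-homo; *-homo; 0#-homo; 1#-homo; -‿homo; ⟦⟧-cong; injective)
  private
    module KP = FieldProperties GFq
    module KF = FiniteField GFq order-K

  -- This and its variants derive an equation as a linear combination of known ones: given the
  -- coefficients, a polynomial identity remains for `solve`.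
  linear₁ : ∀ {x y l r} c → l ≈ r → x ≈ y + c * (l - r) → x ≈ y
  linear₁ {x} {y} {l} {r} c l≈r e = begin
    x                   ≈⟨ e ⟩
    y + c * (l - r)     ≈⟨ +-congˡ (*-congˡ (+-congʳ l≈r)) ⟩
    y + c * (r - r)     ≈⟨ solve 3 (λ y c r → y :+ c :* (r :- r) := y) refl y c r ⟩
    y                   ∎

  linear₂ : ∀ {x y l r l′ r′} c c′ → l ≈ r → l′ ≈ r′ → x ≈ y + c * (l - r) + c′ * (l′ - r′) → x ≈ y
  linear₂ c c′ e e′ f = linear₁ c e (linear₁ c′ e′ f)

  linear₃ : ∀ {x y l r l′ r′ l″ r″} c c′ c″ → l ≈ r → l′ ≈ r′ → l″ ≈ r″ →
            x ≈ y + c * (l - r) + c′ * (l′ - r′) + c″ * (l″ - r″) → x ≈ y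
  linear₃ c c′ c″ e e′ e″ f = linear₂ c c′ e e′ (linear₁ c″ e″ f)

  x²≈0⇒x≈0 : ∀ {x} → x * x ≈ 0# → x ≈ 0#
  x²≈0⇒x≈0 {x} x²≈0 with x ≟ 0#
  ... | yes x≈0 = x≈0
  ... | no  x≉0 = x*y≈0⇒y≈0 x≉0 x²≈0

  x²≈y²⇒x≈±y : ∀ {x y} → x * x ≈ y * y → x ≈ y ⊎ x ≈ - y
  x²≈y²⇒x≈±y {x} {y} x²≈y² with x ≟ y
  ... | yes x≈y = inj₁ x≈y
  ... | no  x≉y = inj₂ (inverseʳ-unique y x (x*y≈0⇒y≈0 (λ e → x≉y (x∙y⁻¹≈ε⇒x≈y x y e))
    (linear₁ 1# x²≈y²
      (solve 2 (λ x y → (x :- y) :* (y :+ x) := con ℤ.0ℤ :+ con ℤ.1ℤ :* (x :* x :- y :* y)) refl x y))))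

  -- The larger field has order `(p ^ m) ^ 2`, so two roots are taken to descend to `p`.
  2≉0 : 1# + 1# ≉ 0#
  2≉0 = FieldProperties.characteristic-odd GFq² 2∤p
    (characteristic-root p m (characteristic-root (p ^ m) 2 order·1≈0))

  2≉0ᴷ : K.1# K.+ K.1# K.≉ K.0#
  2≉0ᴷ = KP.characteristic-odd 2∤p (KF.characteristic-root p m KF.order·1≈0)

  x+x≈0⇒x≈0 : ∀ {x} → x + x ≈ 0# → x ≈ 0#
  x+x≈0⇒x≈0 {x} x+x≈0 = x*y≈0⇒y≈0 2≉0
    (trans (solve 1 (λ x → (con ℤ.1ℤ :+ con ℤ.1ℤ) :* x := x :+ x) refl x) x+x≈0)

  -- Conjugation

  conj-cong : ∀ {x y} → x ≈ y → conj x ≈ conj y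
  conj-cong = ^-congˡ (p ^ m)

  conj-+ : ∀ x y → conj (x + y) ≈ conj x + conj y
  conj-+ = Frobenius.frobenius^-+ commutativeSemiring p-prime
    (characteristic-root p m (characteristic-root (p ^ m) 2 order·1≈0)) m

  conj-* : ∀ x y → conj (x * y) ≈ conj x * conj y
  conj-* x y = ^-distrib-* x y (p ^ m)

  conj-involutive : ∀ x → conj (conj x) ≈ x
  conj-involutive x = begin
    (x ^ʳ q) ^ʳ q        ≈⟨ ^-assocʳ x q q ⟩
    x ^ʳ (q ℕ.* q)       ≈⟨ ^-congʳ x (≡.cong (q ℕ.*_) (≡.sym (ℕ.*-identityʳ q))) ⟩
    x ^ʳ (q ^ 2)         ≈⟨ ^-order x ⟩
    x                    ∎
    where q = p ^ m

  ι-^ : ∀ x n → ι (x K.^ n) ≈ ι x ^ʳ n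
  ι-^ x zero    = 1#-homo
  ι-^ x (suc n) = trans (*-homo x (x K.^ n)) (*-congˡ (ι-^ x n))

  conj-ι : ∀ x → conj (ι x) ≈ ι x
  conj-ι x = trans (sym (ι-^ x (p ^ m))) (⟦⟧-cong (KF.^-order x))

  conj-0 : conj 0# ≈ 0#
  conj-0 = trans (conj-cong (sym 0#-homo)) (trans (conj-ι K.0#) 0#-homo)

  conj-neg : ∀ x → conj (- x) ≈ - conj x
  conj-neg x = inverseʳ-unique (conj x) (conj (- x))
    (trans (sym (conj-+ x (- x))) (trans (conj-cong (-‿inverseʳ x)) conj-0))

  conj-≉0 : ∀ {x} → x ≉ 0# → conj x ≉ 0#
  conj-≉0 x≉0 x̄≈0 = x≉0 (trans (sym (conj-involutive _)) (trans (conj-cong x̄≈0) conj-0))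

  ι-≉0 : ∀ {x} → x K.≉ K.0# → ι x ≉ 0#
  ι-≉0 x≉0 ιx≈0 = x≉0 (injective (trans ιx≈0 (sym 0#-homo)))

  norm≉0⇒≉0 : ∀ {n z} → n ≉ 0# → z * conj z ≈ n → z ≉ 0#
  norm≉0⇒≉0 n≉0 zz̄≈n z≈0 = n≉0 (trans (sym zz̄≈n) (trans (*-congʳ z≈0) (zeroˡ _)))

  -- Both types of circle meet a circle around 0 in such a set, `s` being a centre or a normal
  -- vector; tangency thus gets a uniform treatment.
  OnChord : (s t n z : Carrier) → Set ℓ₂
  OnChord s t n z = z * conj z ≈ n × conj s * z + s * conj z ≈ t

  OnlyPoint : (s t n z : Carrier) → Set (c₂ ⊔ ℓ₂)
  OnlyPoint s t n z = OnChord s t n z × (∀ w → OnChord s t n w → w ≈ z)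

  module _ {s t n : Carrier} where

    OnChord-resp : ∀ {z w} → z ≈ w → OnChord s t n z → OnChord s t n w
    OnChord-resp z≈w (zz̄≈n , e) =
      trans (*-cong (sym z≈w) (conj-cong (sym z≈w))) zz̄≈n ,
      trans (+-cong (*-congˡ (sym z≈w)) (*-congˡ (conj-cong (sym z≈w)))) e

    OnlyPoint-resp : ∀ {z w} → z ≈ w → OnlyPoint s t n z → OnlyPoint s t n w
    OnlyPoint-resp z≈w (on , unique) = OnChord-resp z≈w on , λ v v∈ → trans (unique v v∈) z≈w

    -- For `s ≈ 0#` the linear equation does not depend on the point, so `- z` is a solution along
    -- with `z`. Uniqueness then gives 2z = 0, although `z` has nonzero norm.
    onlyPoint⇒s≉0 : ∀ {z} → n ≉ 0# → OnlyPoint s t n z → s ≉ 0#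
    onlyPoint⇒s≉0 {z} n≉0 ((zz̄≈n , e) , unique) s≈0 =
      norm≉0⇒≉0 n≉0 zz̄≈n (x+x≈0⇒x≈0 (trans (+-congʳ (sym -z≈z)) (-‿inverseˡ z)))
      where
      line≈0 : ∀ w → conj s * w + s * conj w ≈ 0#
      line≈0 w = begin
        conj s * w + s * conj w   ≈⟨ +-cong (*-congʳ (trans (conj-cong s≈0) conj-0)) (*-congʳ s≈0) ⟩
        0# * w + 0# * conj w      ≈⟨ +-cong (zeroˡ w) (zeroˡ _) ⟩
        0# + 0#                   ≈⟨ +-identityˡ 0# ⟩
        0#                        ∎

      -z≈z : - z ≈ z
      -z≈z = unique (- z)
        ( trans (*-congˡ (conj-neg z)) (trans (solve 2 (λ z z̄ → :- z :* :- z̄ := z :* z̄) refl z (conj z)) zz̄≈n)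
        , trans (line≈0 (- z)) (trans (sym (line≈0 z)) e))

    -- The reflection z ↦ (s / s̄) z̄ in the line through 0 and s maps the chord to itself.
    onlyPoint⇒radial : ∀ {z} → n ≉ 0# → OnlyPoint s t n z → conj s * z ≈ s * conj z
    onlyPoint⇒radial {z} n≉0 only@((zz̄≈n , e) , unique) =
      trans (*-congˡ (sym (unique w (ww̄≈n , trans (+-cong s̄w sw̄) (trans (+-comm _ _) e))))) s̄w
      where
      s≉0 : s ≉ 0#
      s≉0 = onlyPoint⇒s≉0 n≉0 only

      s̄⁻¹ : AlgebraDefinitions.Invertible _≈_ 1# _*_ (conj s)
      s̄⁻¹ = inverse (conj s) (conj-≉0 s≉0)

      w : Carrier
      w = proj₁ s̄⁻¹ * (s * conj z)

      s̄w : conj s * w ≈ s * conj z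
      s̄w = trans (sym (*-assoc _ _ _)) (trans (*-congʳ (proj₂ (proj₂ s̄⁻¹))) (*-identityˡ _))

      -- Conjugating `s̄w` shows that passing from `z` to `w` swaps the two summands of the linear
      -- equation.
      sw̄ : s * conj w ≈ conj s * z
      sw̄ = begin
        s * conj w                ≈⟨ *-congʳ (conj-involutive s) ⟨
        conj (conj s) * conj w    ≈⟨ conj-* (conj s) w ⟨
        conj (conj s * w)         ≈⟨ conj-cong s̄w ⟩
        conj (s * conj z)         ≈⟨ conj-* s (conj z) ⟩
        conj s * conj (conj z)    ≈⟨ *-congˡ (conj-involutive z) ⟩
        conj s * z                ∎

      ww̄≈n : w * conj w ≈ n
      ww̄≈n = *-cancelˡ-≉0 (*-≉0 (conj-≉0 s≉0) s≉0) (begin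
        conj s * s * (w * conj w)     ≈⟨ solve 4 (λ s̄ s w w̄ → s̄ :* s :* (w :* w̄) := (s̄ :* w) :* (s :* w̄))
                                           refl (conj s) s w (conj w) ⟩
        (conj s * w) * (s * conj w)   ≈⟨ *-cong s̄w sw̄ ⟩
        (s * conj z) * (conj s * z)   ≈⟨ solve 4 (λ s̄ s z z̄ → (s :* z̄) :* (s̄ :* z) := s̄ :* s :* (z :* z̄))
                                           refl (conj s) s z (conj z) ⟩
        conj s * s * (z * conj z)     ≈⟨ *-congˡ zz̄≈n ⟩
        conj s * s * n                ∎)

    -- For w on the chord, s̄w and s w̄ have the same sum and product as the equal
    -- numbers s̄z and s z̄, so that (s̄w - s̄z)² = 0.
    radial⇒onlyPoint : ∀ {z} → s ≉ 0# → OnChord s t n z → conj s * z ≈ s * conj z → OnlyPoint s t n z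
    radial⇒onlyPoint {z} s≉0 on@(zz̄≈n , e) x≈y = on , λ w (ww̄≈n , e′) →
      *-cancelˡ-≉0 (conj-≉0 s≉0) (x∙y⁻¹≈ε⇒x≈y _ _ (x²≈0⇒x≈0
        (linear₃ (conj s * w) (- 1#) (- (conj s * w - conj s * z))
          (trans e′ (sym e))
          (*-congˡ {conj s * s} (trans ww̄≈n (sym zz̄≈n)))
          x≈y
          (solve 6 (λ s̄ s w w̄ z z̄ →
              (s̄ :* w :- s̄ :* z) :* (s̄ :* w :- s̄ :* z) :=
              con ℤ.0ℤ :+ s̄ :* w :* ((s̄ :* w :+ s :* w̄) :- (s̄ :* z :+ s :* z̄))
                :+ :- con ℤ.1ℤ :* (s̄ :* s :* (w :* w̄) :- s̄ :* s :* (z :* z̄))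
                :+ :- (s̄ :* w :- s̄ :* z) :* (s̄ :* z :- s :* z̄))
            refl (conj s) s w (conj w) z (conj z)))))

  -- Circles as chords of the circles around 0

  centre : Circle → Carrier
  centre (B¹ s _)       = s
  centre (B² (s , _) _) = s

  -- On a circle z z̄ = n around 0, the circle k is cut out by s̄z + s z̄ = chord k n.
  chord : Circle → Carrier → Carrier
  chord (B¹ s (c , _)) n = n + s * conj s - ι c
  chord (B² s c)       n = ι c

  -- Expanding (z - s)(z̄ - s̄) = c and replacing z z̄ by `n` leaves a linear equation; a circle of
  -- the second type already has one.
  ∈⇒chord : ∀ k {z n} → z * conj z ≈ n → [ z ] ∈ ⟦ k ⟧ → OnChord (centre k) (chord k n) n z
  ∈⇒chord (B¹ s (c , _)) {z} {n} zz̄≈n z∈k = zz̄≈n , linear₂ 1# (- 1#) zz̄≈n z∈k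
    (solve 6 (λ s s̄ z z̄ n c →
        s̄ :* z :+ s :* z̄ :=
        (n :+ s :* s̄ :- c) :+ con ℤ.1ℤ :* (z :* z̄ :- n) :+ :- con ℤ.1ℤ :* ((z :- s) :* (z̄ :- s̄) :- c))
      refl s (conj s) z (conj z) n (ι c))
  ∈⇒chord (B² s c) zz̄≈n z∈k = zz̄≈n , z∈k

  chord⇒∈ : ∀ k {z n} → OnChord (centre k) (chord k n) n z → [ z ] ∈ ⟦ k ⟧
  chord⇒∈ (B¹ s (c , _)) {z} {n} (zz̄≈n , e) = linear₂ 1# (- 1#) zz̄≈n e
    (solve 6 (λ s s̄ z z̄ n c →
        (z :- s) :* (z̄ :- s̄) :=
        c :+ con ℤ.1ℤ :* (z :* z̄ :- n) :+ :- con ℤ.1ℤ :* ((s̄ :* z :+ s :* z̄) :- (n :+ s :* s̄ :- c)))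
      refl s (conj s) z (conj z) n (ι c))
  chord⇒∈ (B² s c) (_ , e) = e

  norm-shift : ∀ z → (z - 0#) * (conj z - conj 0#) ≈ z * conj z
  norm-shift z = trans (*-congˡ (+-congˡ (-‿cong conj-0)))
    (solve 2 (λ z z̄ → (z :- con ℤ.0ℤ) :* (z̄ :- con ℤ.0ℤ) := z :* z̄) refl z (conj z))

  module _ (k : Circle) (a : K.Carrier*) where
    private
      n : Carrier
      n = ι (proj₁ a)

    ∩⇒chord : ∀ {z} → [ z ] ∈ ⟦ k ⟧ × [ z ] ∈ ⟦ 𝓑 a ⟧ → OnChord (centre k) (chord k n) n z
    ∩⇒chord {z} (z∈k , z∈𝓑) = ∈⇒chord k (trans (sym (norm-shift z)) z∈𝓑) z∈k

    chord⇒∩ : ∀ {z} → OnChord (centre k) (chord k n) n z → [ z ] ∈ ⟦ k ⟧ × [ z ] ∈ ⟦ 𝓑 a ⟧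
    chord⇒∩ {z} on = chord⇒∈ k on , trans (norm-shift z) (proj₁ on)

    OnlyCommonPoint : Carrier → Set (c₂ ⊔ ℓ₂)
    OnlyCommonPoint = OnlyPoint (centre k) (chord k n) n

    tangentialIn⇒only : ∀ {z} → TangentialIn k (𝓑 a) [ z ] → OnlyCommonPoint z
    tangentialIn⇒only (∩⊆z , z⊆∩) =
      ∩⇒chord (z⊆∩ [ refl ]) , λ w w∈ → [≈]-injective _≈_ (∩⊆z {[ w ]} (chord⇒∩ w∈))

    only⇒tangentialIn : ∀ {z} → OnlyCommonPoint z → TangentialIn k (𝓑 a) [ z ]
    only⇒tangentialIn {z} (on , unique) = ∩⊆z , z⊆∩
      where
      ∩⊆z : ∀ {w} → w ∈ ⟦ k ⟧ × w ∈ ⟦ 𝓑 a ⟧ → w ≈ₚ [ z ]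
      -- The point `∞` is not on `𝓑 a`, so only finite points matter, even if `k` contains `∞`.
      ∩⊆z {∞}     (_ , ())
      ∩⊆z {[ w ]} w∈ = [ unique w (∩⇒chord w∈) ]
      z⊆∩ : ∀ {w} → w ≈ₚ [ z ] → w ∈ ⟦ k ⟧ × w ∈ ⟦ 𝓑 a ⟧
      z⊆∩ [ w≈z ] = chord⇒∩ (OnChord-resp (sym w≈z) on)

    tangential⇒only : Tangential k (𝓑 a) → ∃ OnlyCommonPoint
    tangential⇒only (∞     , (_ , ()) , _)
    tangential⇒only ([ z ] , z∈ , unique) =
      z , ∩⇒chord z∈ , λ w w∈ → sym ([≈]-injective _≈_ (unique {[ w ]} (chord⇒∩ w∈)))

    only⇒tangential : ∀ {z} → OnlyCommonPoint z → Tangential k (𝓑 a)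
    only⇒tangential {z} (on , unique) = [ z ] , chord⇒∩ on , z-unique
      where
      z-unique : ∀ {w} → w ∈ ⟦ k ⟧ × w ∈ ⟦ 𝓑 a ⟧ → [ z ] ≈ₚ w
      z-unique {∞}     (_ , ())
      z-unique {[ w ]} w∈ = [ sym (unique w (∩⇒chord w∈)) ]

  B¹-cong : ∀ {s s′ c c′} → s ≈ s′ → ι (proj₁ c) ≈ ι (proj₁ c′) → B¹ s c ≈ᶜ B¹ s′ c′
  B¹-cong s≈s′ c≈c′ = (λ {z} → transport s≈s′ c≈c′ z) , (λ {z} → transport (sym s≈s′) (sym c≈c′) z)
    where
    transport : ∀ {s s′ c c′} → s ≈ s′ → ι (proj₁ c) ≈ ι (proj₁ c′) →
                ∀ z → z ∈ ⟦ B¹ s c ⟧ → z ∈ ⟦ B¹ s′ c′ ⟧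
    transport s≈s′ c≈c′ [ z ] z∈ = trans
      (*-cong (+-congˡ (-‿cong (sym s≈s′))) (+-congˡ (-‿cong (conj-cong (sym s≈s′))))) (trans z∈ c≈c′)

  -- The common tangent touching in P and ε P

  module CommonTangent {a b : K.Carrier} (a≉0 : a K.≉ K.0#) (b≉0 : b K.≉ K.0#) {P : Carrier} (PP̄≈a : P * conj P ≈ ι a)
                       (ε : K.Carrier) (ε²a≈b : ε K.* ε K.* a K.≈ b) (ε²≉1 : ε K.* ε K.≉ K.1#) where

    private
      open HalfSumAndDifference GFq 2≉0ᴷ ε ε²≉1 using () renaming
        ( half-sum to λᴷ; half-difference to ρᴷ; half-sum≉0 to λ≉0ᴷ; half-difference≉0 to ρ≉0ᴷ
        ; sum≈1 to λ+ρ≈1ᴷ; difference≈ε to λ-ρ≈εᴷ)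

      λᴸ ρᴸ e n : Carrier
      λᴸ = ι λᴷ
      ρᴸ = ι ρᴷ
      e  = ι ε
      n  = ι a

      λ≉0 : λᴸ ≉ 0#
      λ≉0 = ι-≉0 λ≉0ᴷ

      ρ≉0 : ρᴸ ≉ 0#
      ρ≉0 = ι-≉0 ρ≉0ᴷ

      λ+ρ≈1 : λᴸ + ρᴸ ≈ 1#
      λ+ρ≈1 = trans (sym (+-homo λᴷ ρᴷ)) (trans (⟦⟧-cong λ+ρ≈1ᴷ) 1#-homo)

      λ-ρ≈e : λᴸ - ρᴸ ≈ e
      λ-ρ≈e = trans (+-congˡ (sym (-‿homo ρᴷ))) (trans (sym (+-homo λᴷ (K.- ρᴷ))) (⟦⟧-cong λ-ρ≈εᴷ))

      e²n≈b : e * e * n ≈ ι b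
      e²n≈b = trans (*-congʳ (sym (*-homo ε ε))) (trans (sym (*-homo (ε K.* ε) a)) (⟦⟧-cong ε²a≈b))

      P≉0 : P ≉ 0#
      P≉0 = norm≉0⇒≉0 (ι-≉0 a≉0) PP̄≈a

      conj-scale : ∀ x z → conj (ι x * z) ≈ ι x * conj z
      conj-scale x z = trans (conj-* (ι x) z) (*-congʳ (conj-ι x))

    -- This is the norm of ρ P = (P - ε P) / 2, which is half the diameter.
    radius² : K.Carrier*
    radius² = ρᴷ K.* ρᴷ K.* a , KP.*-≉0 (KP.*-≉0 ρ≉0ᴷ ρ≉0ᴷ) a≉0

    -- The circle with diameter from P to ε P.
    circle : Circle
    circle = B¹ (λᴸ * P) radius²

    private
      s : Carrier
      s = λᴸ * P

      ι-radius² : ι (ρᴷ K.* ρᴷ K.* a) ≈ ρᴸ * ρᴸ * (P * conj P)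
      ι-radius² = trans (*-homo (ρᴷ K.* ρᴷ) a) (*-cong (*-homo ρᴷ ρᴷ) (sym PP̄≈a))

    P∈circle : [ P ] ∈ ⟦ circle ⟧
    P∈circle = begin
      (P - s) * (conj P - conj s)             ≈⟨ *-congˡ (+-congˡ (-‿cong (conj-scale λᴷ P))) ⟩
      (P - λᴸ * P) * (conj P - λᴸ * conj P)   ≈⟨ solve 3 (λ l z z̄ →
                                                   (z :- l :* z) :* (z̄ :- l :* z̄) :=
                                                   (con ℤ.1ℤ :- l) :* (con ℤ.1ℤ :- l) :* (z :* z̄))
                                                   refl λᴸ P (conj P) ⟩
      (1# - λᴸ) * (1# - λᴸ) * (P * conj P)    ≈⟨ *-congʳ (*-cong 1-λ≈ρ 1-λ≈ρ) ⟩
      ρᴸ * ρᴸ * (P * conj P)                  ≈⟨ ι-radius² ⟨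
      ι (ρᴷ K.* ρᴷ K.* a)                     ∎
      where
      1-λ≈ρ : 1# - λᴸ ≈ ρᴸ
      1-λ≈ρ = linear₁ (- 1#) λ+ρ≈1 (solve 2 (λ l r →
        con ℤ.1ℤ :- l := r :+ :- con ℤ.1ℤ :* ((l :+ r) :- con ℤ.1ℤ)) refl λᴸ ρᴸ)

    -- Since ε = λ - ρ, the difference of ε P and the centre λ P is - ρ P, opposite to that of `P`.
    εP∈circle : [ e * P ] ∈ ⟦ circle ⟧
    εP∈circle = begin
      (e * P - s) * (conj (e * P) - conj s)   ≈⟨ *-congˡ (+-cong (conj-scale ε P) (-‿cong (conj-scale λᴷ P))) ⟩
      (e * P - λᴸ * P) * (e * conj P - λᴸ * conj P)
                                              ≈⟨ *-cong (+-congʳ (*-congʳ λ-ρ≈e)) (+-congʳ (*-congʳ λ-ρ≈e)) ⟨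
      ((λᴸ - ρᴸ) * P - λᴸ * P) * ((λᴸ - ρᴸ) * conj P - λᴸ * conj P)
                                              ≈⟨ solve 4 (λ l r z z̄ →
                                                   ((l :- r) :* z :- l :* z) :* ((l :- r) :* z̄ :- l :* z̄) :=
                                                   r :* r :* (z :* z̄))
                                                   refl λᴸ ρᴸ P (conj P) ⟩
      ρᴸ * ρᴸ * (P * conj P)                  ≈⟨ ι-radius² ⟨
      ι (ρᴷ K.* ρᴷ K.* a)                     ∎

    -- The centre is a multiple of `P` by an element of GF(q), which conjugation fixes; this makes
    -- `P` radial.
    P-onlyCommonPoint : OnlyCommonPoint circle (a , a≉0) P
    P-onlyCommonPoint = radial⇒onlyPoint (*-≉0 λ≉0 P≉0) (∈⇒chord circle PP̄≈a P∈circle) (begin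
      conj s * P           ≈⟨ *-congʳ (conj-scale λᴷ P) ⟩
      λᴸ * conj P * P      ≈⟨ solve 3 (λ l z z̄ → l :* z̄ :* z := l :* z :* z̄) refl λᴸ P (conj P) ⟩
      λᴸ * P * conj P      ∎)

    norm-εP : (e * P) * conj (e * P) ≈ ι b
    norm-εP = begin
      (e * P) * conj (e * P)    ≈⟨ *-congˡ (conj-scale ε P) ⟩
      (e * P) * (e * conj P)    ≈⟨ solve 3 (λ e z z̄ → (e :* z) :* (e :* z̄) := e :* e :* (z :* z̄)) refl e P (conj P) ⟩
      e * e * (P * conj P)      ≈⟨ *-congˡ PP̄≈a ⟩
      e * e * n                 ≈⟨ e²n≈b ⟩
      ι b                       ∎

    εP-onlyCommonPoint : OnlyCommonPoint circle (b , b≉0) (e * P)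
    εP-onlyCommonPoint = radial⇒onlyPoint (*-≉0 λ≉0 P≉0) (∈⇒chord circle norm-εP εP∈circle) (begin
      conj s * (e * P)           ≈⟨ *-congʳ (conj-scale λᴷ P) ⟩
      λᴸ * conj P * (e * P)      ≈⟨ solve 4 (λ l e z z̄ → l :* z̄ :* (e :* z) := l :* z :* (e :* z̄)) refl λᴸ e P (conj P) ⟩
      λᴸ * P * (e * conj P)      ≈⟨ *-congˡ (conj-scale ε P) ⟨
      λᴸ * P * conj (e * P)      ∎)

    circle-τ : circle ∈ τ (a , a≉0) (b , b≉0)
    circle-τ = only⇒tangential circle (a , a≉0) P-onlyCommonPoint ,
               only⇒tangential circle (b , b≉0) εP-onlyCommonPoint

    circle-unique : ∀ k {Q} → OnlyCommonPoint k (a , a≉0) P → OnlyCommonPoint k (b , b≉0) Q →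
                    Q ≈ e * P → k ≈ᶜ circle
    circle-unique (B² (s , s≉0) c) {Q} P-only@((_ , P-on) , _) Q-only@((_ , Q-on) , _) Q≈eP =
      ⊥-elim (ε²≉1 (K.trans (K.*-cong ε≈1 ε≈1) (K.*-identityˡ K.1#)))
      where
      -- Both linear equations have the right-hand side `ι c`, and at a point of tangency their two
      -- summands agree.
      s̄P≈s̄Q : conj s * P ≈ conj s * Q
      s̄P≈s̄Q = *-cancelˡ-≉0 2≉0 (linear₃ 1# 1# (- 1#)
        (trans P-on (sym Q-on))
        (onlyPoint⇒radial (ι-≉0 a≉0) P-only)
        (onlyPoint⇒radial (ι-≉0 b≉0) Q-only)
        (solve 4 (λ x x′ y y′ → (con ℤ.1ℤ :+ con ℤ.1ℤ) :* x :=
            (con ℤ.1ℤ :+ con ℤ.1ℤ) :* y :+ con ℤ.1ℤ :* ((x :+ x′) :- (y :+ y′))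
              :+ con ℤ.1ℤ :* (x :- x′) :+ :- con ℤ.1ℤ :* (y :- y′))
          refl (conj s * P) (s * conj P) (conj s * Q) (s * conj Q)))

      ε≈1 : ε K.≈ K.1#
      ε≈1 = injective (trans (*-cancelˡ-≉0 P≉0 (begin
        P * e     ≈⟨ *-comm P e ⟩
        e * P     ≈⟨ Q≈eP ⟨
        Q         ≈⟨ *-cancelˡ-≉0 (conj-≉0 s≉0) s̄P≈s̄Q ⟨
        P         ≈⟨ *-identityʳ P ⟨
        P * 1#    ∎)) (sym 1#-homo))
    circle-unique (B¹ s′ (c , c≉0)) {Q} P-only@((PP̄≈n , P-on) , _) Q-only@((QQ̄≈b , Q-on) , _) Q≈eP =
      -- As `P` lies on both circles, equal centres force equal radius parameters.
      B¹-cong {c = c , c≉0} {c′ = radius²} s′≈s (begin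
        ι c                                  ≈⟨ chord⇒∈ (B¹ s′ (c , c≉0)) (PP̄≈n , P-on) ⟨
        (P - s′) * (conj P - conj s′)        ≈⟨ *-cong (+-congˡ (-‿cong s′≈s)) (+-congˡ (-‿cong (conj-cong s′≈s))) ⟩
        (P - s) * (conj P - conj s)          ≈⟨ P∈circle ⟩
        ι (ρᴷ K.* ρᴷ K.* a)                  ∎)
      where
      -- Radiality doubles one summand in each linear equation; subtraction eliminates `c` and the
      -- norm of the centre.
      difference : (1# + 1#) * (conj s′ * (Q - P)) ≈ ι b - n
      difference = linear₂ 1# (- 1#) (onlyPoint⇒radial (ι-≉0 b≉0) Q-only) (onlyPoint⇒radial (ι-≉0 a≉0) P-only)
        (linear₂ 1# (- 1#) Q-on P-on
          (solve 9 (λ s̄ P Q x y b n N c →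
              (con ℤ.1ℤ :+ con ℤ.1ℤ) :* (s̄ :* (Q :- P)) :=
              (b :- n) :+ con ℤ.1ℤ :* (s̄ :* Q :- y) :+ :- con ℤ.1ℤ :* (s̄ :* P :- x)
                :+ con ℤ.1ℤ :* ((s̄ :* Q :+ y) :- (b :+ N :- c))
                :+ :- con ℤ.1ℤ :* ((s̄ :* P :+ x) :- (n :+ N :- c)))
            refl (conj s′) P Q (s′ * conj P) (s′ * conj Q) (ι b) n (s′ * conj s′) (ι c)))

      s̄′≈s̄ : conj s′ ≈ λᴸ * conj P
      -- Here Q - P = - 2ρP and b - a = - 4λρ P P̄, so `difference` becomes the desired equation
      -- multiplied by - 4ρP.
      s̄′≈s̄ = *-cancelˡ-≉0 (*-≉0 (*-≉0 2≉0 2≉0) (*-≉0 ρ≉0 P≉0)) (begin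
        2# * 2# * (ρᴸ * P) * conj s′          ≈⟨ solve 4 (λ l r P s̄ →
                                                   𝟐 :* 𝟐 :* (r :* P) :* s̄ :=
                                                   :- (𝟐 :* (s̄ :* ((l :- r) :* P :- (l :+ r) :* P))))
                                                   refl λᴸ ρᴸ P (conj s′) ⟩
        - (2# * (conj s′ * ((λᴸ - ρᴸ) * P - (λᴸ + ρᴸ) * P)))
                                              ≈⟨ -‿cong (*-congˡ (*-congˡ (+-cong
                                                   (trans (*-congʳ λ-ρ≈e) (sym Q≈eP))
                                                   (-‿cong (trans (*-congʳ λ+ρ≈1) (*-identityˡ P)))))) ⟩
        - (2# * (conj s′ * (Q - P)))          ≈⟨ -‿cong difference ⟩
        - (ι b - n)                           ≈⟨ -‿cong (+-cong
                                                   (trans (*-cong (*-cong λ-ρ≈e λ-ρ≈e) PP̄≈a) e²n≈b)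
                                                   (-‿cong (trans (*-cong (*-cong λ+ρ≈1 λ+ρ≈1) PP̄≈a)
                                                     (trans (*-congʳ (*-identityˡ 1#)) (*-identityˡ n))))) ⟨
        - ((λᴸ - ρᴸ) * (λᴸ - ρᴸ) * (P * conj P) - (λᴸ + ρᴸ) * (λᴸ + ρᴸ) * (P * conj P))
                                              ≈⟨ solve 4 (λ l r P P̄ →
                                                   :- ((l :- r) :* (l :- r) :* (P :* P̄) :- (l :+ r) :* (l :+ r) :* (P :* P̄)) :=
                                                   𝟐 :* 𝟐 :* (r :* P) :* (l :* P̄))
                                                   refl λᴸ ρᴸ P (conj P) ⟩
        2# * 2# * (ρᴸ * P) * (λᴸ * conj P)    ∎)
        where
        2# : Carrier
        2# = 1# + 1#
        𝟐 : ∀ {k} → Polynomial k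
        𝟐 = con ℤ.1ℤ :+ con ℤ.1ℤ

      s′≈s : s′ ≈ s
      s′≈s = begin
        s′                    ≈⟨ conj-involutive s′ ⟨
        conj (conj s′)        ≈⟨ conj-cong s̄′≈s̄ ⟩
        conj (λᴸ * conj P)    ≈⟨ conj-scale λᴷ (conj P) ⟩
        λᴸ * conj (conj P)    ≈⟨ *-congˡ (conj-involutive P) ⟩
        s                     ∎

  -- The possible second points of tangency

  module _ {a b : K.Carrier} (a≉0 : a K.≉ K.0#) (b≉0 : b K.≉ K.0#) (μ : K.Carrier) (μ²a≈b : μ K.* μ K.* a K.≈ b)
           {P : Carrier} (PP̄≈a : P * conj P ≈ ι a) where

    -- P and Q lie on the same line through 0 and the centre of k.
    commonPoint≈±μP : ∀ k {Q} → OnlyCommonPoint k (a , a≉0) P → OnlyCommonPoint k (b , b≉0) Q →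
                      Q ≈ ι μ * P ⊎ Q ≈ - (ι μ * P)
    -- The extra factor a = P P̄ supplies the P̄ for exchanging Q P̄ with Q̄ P, which turns Q² into
    -- a norm times P².
    commonPoint≈±μP k {Q} P-only Q-only@((QQ̄≈b , _) , _) = x²≈y²⇒x≈±y (*-cancelˡ-≉0 (ι-≉0 a≉0) (begin
      ι a * (Q * Q)                       ≈⟨ *-congʳ PP̄≈a ⟨
      P * conj P * (Q * Q)                ≈⟨ solve 3 (λ P P̄ Q → P :* P̄ :* (Q :* Q) := Q :* P :* (Q :* P̄))
                                               refl P (conj P) Q ⟩
      Q * P * (Q * conj P)                ≈⟨ *-congˡ QP̄≈Q̄P ⟩
      Q * P * (conj Q * P)                ≈⟨ solve 3 (λ P Q Q̄ → Q :* P :* (Q̄ :* P) := Q :* Q̄ :* (P :* P))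
                                               refl P Q (conj Q) ⟩
      Q * conj Q * (P * P)                ≈⟨ *-congʳ QQ̄≈b ⟩
      ι b * (P * P)                       ≈⟨ *-congʳ (⟦⟧-cong μ²a≈b) ⟨
      ι (μ K.* μ K.* a) * (P * P)         ≈⟨ *-congʳ (trans (*-homo (μ K.* μ) a) (*-congʳ (*-homo μ μ))) ⟩
      ι μ * ι μ * ι a * (P * P)           ≈⟨ solve 3 (λ u n P → u :* u :* n :* (P :* P) := n :* (u :* P :* (u :* P)))
                                               refl (ι μ) (ι a) P ⟩
      ι a * (ι μ * P * (ι μ * P))         ∎))
      where
      s : Carrier
      s = centre k

      s≉0 : s ≉ 0#
      s≉0 = onlyPoint⇒s≉0 (ι-≉0 a≉0) P-only

      QP̄≈Q̄P : Q * conj P ≈ conj Q * P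
      QP̄≈Q̄P = *-cancelˡ-≉0 (*-≉0 (conj-≉0 s≉0) s≉0) (begin
        conj s * s * (Q * conj P)       ≈⟨ solve 4 (λ s̄ s Q P̄ → s̄ :* s :* (Q :* P̄) := (s̄ :* Q) :* (s :* P̄))
                                             refl (conj s) s Q (conj P) ⟩
        (conj s * Q) * (s * conj P)     ≈⟨ *-cong (onlyPoint⇒radial (ι-≉0 b≉0) Q-only)
                                                  (sym (onlyPoint⇒radial (ι-≉0 a≉0) P-only)) ⟩
        (s * conj Q) * (conj s * P)     ≈⟨ solve 4 (λ s̄ s Q̄ P → (s :* Q̄) :* (s̄ :* P) := s̄ :* s :* (Q̄ :* P))
                                             refl (conj s) s (conj Q) P ⟩
        conj s * s * (conj Q * P)       ∎)


  -- The two common tangents through P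

  module TangentPair (a b : K.Carrier*) (μ : K.Carrier) (μ²a≈b : μ K.* μ K.* proj₁ a K.≈ proj₁ b)
                     (μ²≉1 : μ K.* μ K.≉ K.1#) {P : Carrier} (PP̄≈a : P * conj P ≈ ι (proj₁ a)) where

    private
      module KR = RingProperties K.ring

      [-μ]²≈μ² : K.- μ K.* K.- μ K.≈ μ K.* μ
      [-μ]²≈μ² = K.trans (K.sym (KR.-‿distribˡ-* μ (K.- μ)))
        (K.trans (K.-‿cong (K.sym (KR.-‿distribʳ-* μ μ))) (KR.-‿involutive _))

    module G = CommonTangent (proj₂ a) (proj₂ b) PP̄≈a μ μ²a≈b μ²≉1
    module H = CommonTangent (proj₂ a) (proj₂ b) PP̄≈a (K.- μ) (K.trans (K.*-congʳ [-μ]²≈μ²) μ²a≈b)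
                 (λ e → μ²≉1 (K.trans (K.sym [-μ]²≈μ²) e))

    [-μ]P≈-μP : ι (K.- μ) * P ≈ - (ι μ * P)
    [-μ]P≈-μP = trans (*-congʳ (-‿homo μ)) (sym (-‿distribˡ-* (ι μ) P))

    -μP-onlyCommonPoint : OnlyCommonPoint H.circle b (- (ι μ * P))
    -μP-onlyCommonPoint = OnlyPoint-resp [-μ]P≈-μP H.εP-onlyCommonPoint

    -- The point μP lies on the first circle and on `𝓑 b`, but the second meets `𝓑 b` only in - μP;
    -- equality would give 2μP = 0.
    G≉H : ¬ (G.circle ≈ᶜ H.circle)
    G≉H (G⊆H , _) = norm≉0⇒≉0 (ι-≉0 (proj₂ b)) G.norm-εP
      (x+x≈0⇒x≈0 (trans (+-congʳ μP≈-μP) (-‿inverseˡ _)))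
      where
      μP≈-μP : ι μ * P ≈ - (ι μ * P)
      μP≈-μP = proj₂ -μP-onlyCommonPoint (ι μ * P)
        (∈⇒chord H.circle G.norm-εP (G⊆H {[ ι μ * P ]} G.εP∈circle))

    -- The sign in Q = ± μP selects the circle, and `circle-unique` for that sign identifies it with
    -- `k`.
    classify : ∀ k → k ∈ τ a b → TangentialIn k (𝓑 a) [ P ] → k ≈ᶜ G.circle ⊎ k ≈ᶜ H.circle
    classify k (_ , k-tangential-b) k-tangential-a-P =
      by-position (commonPoint≈±μP (proj₂ a) (proj₂ b) μ μ²a≈b PP̄≈a k P-only Q-only)
      where
      P-only : OnlyCommonPoint k a P
      P-only = tangentialIn⇒only k a k-tangential-a-P

      Q : Carrier
      Q = proj₁ (tangential⇒only k b k-tangential-b)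

      Q-only : OnlyCommonPoint k b Q
      Q-only = proj₂ (tangential⇒only k b k-tangential-b)

      by-position : Q ≈ ι μ * P ⊎ Q ≈ - (ι μ * P) → k ≈ᶜ G.circle ⊎ k ≈ᶜ H.circle
      by-position (inj₁ Q≈μP)  = inj₁ (G.circle-unique k P-only Q-only Q≈μP)
      by-position (inj₂ Q≈-μP) = inj₂ (H.circle-unique k P-only Q-only (trans Q≈-μP (sym [-μ]P≈-μP)))

mainTheorem5 : ∀ {c₁ ℓ₁ c₂ ℓ₂} (p m : ℕ) → Prime p → ¬ (2 ∣ p) → 1 ≤ m →
    (E : QuadraticExtension (p ^ m) c₁ ℓ₁ c₂ ℓ₂) →
    let open MöbiusPlane E in
    (a b : K.Carrier*) (μ : K.Carrier) →
    μ K.^ 2 K.≈ proj₁ b K./ a →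
    ¬ (proj₁ b K./ a K.≈ K.1#) →
    (P : L.Carrier) → [ P ] ∈ ⟦ 𝓑 a ⟧ →
    ∃₂ λ (g h : Circle) →
    (g ∈ τ a b × TangentialIn g (𝓑 a) [ P ]) ×
    (h ∈ τ a b × TangentialIn h (𝓑 a) [ P ]) ×
    ¬ (g ≈ᶜ h) ×
    (∀ (k : Circle) → k ∈ τ a b → TangentialIn k (𝓑 a) [ P ] → k ≈ᶜ g ⊎ k ≈ᶜ h) ×
    TangentialIn g (𝓑 b) [ ι μ L.* P ] ×
    TangentialIn h (𝓑 b) [ L.- (ι μ L.* P) ]
mainTheorem5 p m p-prime 2∤p _ E a b μ μ²≈b/a b/a≉1 P P∈𝓑 =
  G.circle , H.circle ,
  (G.circle-τ , only⇒tangentialIn G.circle a G.P-onlyCommonPoint) ,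
  (H.circle-τ , only⇒tangentialIn H.circle a H.P-onlyCommonPoint) ,
  G≉H , classify ,
  only⇒tangentialIn G.circle b G.εP-onlyCommonPoint ,
  only⇒tangentialIn H.circle b -μP-onlyCommonPoint
  where
  open MöbiusPlane E
  open Tangency p m p-prime 2∤p E

  a⁻¹ : AlgebraDefinitions.Invertible K._≈_ K.1# K._*_ (proj₁ a)
  a⁻¹ = K.inverse (proj₁ a) (proj₂ a)

  μ*μ≈b/a : μ K.* μ K.≈ proj₁ b K./ a
  -- The power `μ K.^ 2` unfolds to μ (μ 1), hence the trailing unit.
  μ*μ≈b/a = K.trans (K.*-congˡ (K.sym (K.*-identityʳ μ))) μ²≈b/a

  μ²a≈b : μ K.* μ K.* proj₁ a K.≈ proj₁ b
  μ²a≈b = K.trans (K.*-congʳ μ*μ≈b/a)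
    (K.trans (K.*-assoc _ _ _) (K.trans (K.*-congˡ (proj₁ (proj₂ a⁻¹))) (K.*-identityʳ _)))

  open TangentPair a b μ μ²a≈b (λ μ²≈1 → b/a≉1 (K.trans (K.sym μ*μ≈b/a) μ²≈1))
    (L.trans (L.sym (norm-shift P)) P∈𝓑)
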